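{- Let $R\in\mathcal{R}_{123}$. Then the interval $[\langle\cdot\rangle_=,R]$ of $(\mathcal{R}_{123},\leqslant)$ is a lattice under the operations $\wedge$ and $\vee$ defined, for all $T,T'\in[\langle\cdot\rangle_=,R]$, by: (i) $T\wedge T'=S$, where $\mathcal{I}^S_{11}=\mathcal{I}^T_{11}\cup\mathcal{I}^{T'}_{11}\cup\bigcup_{(a,b)\neq(1,1)}\big(\mathcal{I}^T_{ab}\oplus\mathcal{I}^{T'}_{ab}\big)$ and $\mathcal{I}^S_{ab}=\mathcal{I}^T_{ab}\cap\mathcal{I}^{T'}_{ab}$ for every $(a,b)\neq(1,1)$; (ii) $T\vee T'=S$, where $\mathcal{I}^S_{11}=\mathcal{I}^T_{11}\cap\mathcal{I}^{T'}_{11}$ and $\mathcal{I}^S_{ab}=\mathcal{I}^T_{ab}\cup\mathcal{I}^{T'}_{ab}$ for every $(a,b)\neq(1,1)$. Moreover, $([\langle\cdot\rangle_=,R],\leqslant)$ is order-isomorphic to $\big(\mathcal{P}\big(\bigcup_{(a,b)\neq(1,1)}\mathcal{I}^R_{ab}\big),\subseteq\big)$, the power set ordered by inclusion.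
   Context: Sequences: $\mathcal{S}$ is the set of finite multisets of nonzero integers (including the empty one, $\varepsilon$). If $n_1>\dots>n_q\geqslant 1$ are the distinct absolute values occurring in $\sigma\in\mathcal{S}$, encode $\sigma$ by the pairs $(p_1,m_1),\dots,(p_q,m_q)$, where $p_k$ (resp. $m_k$) is the number of occurrences of $n_k$ (resp. $-n_k$) in $\sigma$; no pair is $(0,0)$. $\mathcal{S}_0$ is the set of $\sigma$ with $p_1>0$ and $m_1>0$. Elementary rules $\rho_1,\rho_2,\rho_3:\mathcal{S}\to\mathcal{S}$ act only if $p_1>0$ and $m_1>0$ (otherwise $\rho_i(\sigma)=\sigma$): $\rho_1$ replaces $p_1$ by $1$; $\rho_2$ replaces $m_1$ by $1$; $\rho_3$ replaces $(p_1,m_1)$ by $(p_1-c,m_1-c)$ with $c=\min(p_1,m_1)$, and if this gives $(0,0)$ the pair is removed and the subsequent pairs are renumbered. Words in the $\rho_i$ are read from left to right (the leftmost letter is applied first), may be infinite, and $w^*$ denotes $www\cdots$; since letters only delete terms of a finite sequence, the result $R(\sigma)$ of applying an infinite word is the eventual constant value. $\mathcal{R}_{123}$ is the set of infinite words $T=T_1T_2\cdots$ with each factor $T_i=\rho_1^{a}\rho_2^{b}\rho_3$ for some $a,b\in\{0,1\}$ (distinct such factor sequences are distinct elements). For $T\in\mathcal{R}_{123}$, $\mathcal{I}^T_{ab}=\{i\in\mathbb{N}: T_i=\rho_1^a\rho_2^b\rho_3\}$, where $\mathbb{N}=\{1,2,\dots\}$ indexes the factors; the four sets $\mathcal{I}^T_{ab}$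 partition $\mathbb{N}$ and determine $T$. $\langle\cdot\rangle_= =(\rho_1\rho_2\rho_3)^*$. Order: $T\leqslant T'$ iff for every $\sigma\in\mathcal{S}$ the terms of $\sigma$ deleted by $T$ include those deleted by $T'$, i.e. $T(\sigma)$ is a sub-multiset of $T'(\sigma)$. $[U,R]=\{T\in\mathcal{R}_{123}: U\leqslant T\leqslant R\}$, and $\oplus$ is symmetric difference of sets. -}

module Defs where

open import Data.Bool.Base using (Bool; true; false; if_then_else_)
open import Data.Integer.Base using (ℤ; +_; -_; ∣_∣)
import Data.Integer.Base as ℤ
import Data.Integer.Properties as ℤ
open import Data.List.Base
  using (List; []; _∷_; _++_; length; map; filter; replicate; foldl; concatMap; applyUpTo)
open import Data.List.Extrema.Nat using (max)
open import Data.List.Properties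
  using (length-++; length-replicate; foldl-++; filter-accept; filter-reject)
open import Data.List.Relation.Binary.Permutation.Propositional using (_↭_; ↭-reflexive)
open import Data.List.Relation.Unary.All using (All; []; _∷_)
import Data.List.Relation.Unary.All.Properties as All
open import Data.Nat.Base using (ℕ; zero; suc; _+_; _∸_; _⊓_; _≤_; _<_; z≤n; s≤s; s≤s⁻¹)
import Data.Nat.Base as ℕ
import Data.Nat.Properties as ℕ
open import Data.Product.Base using (Σ; ∃; _×_; _,_; proj₁; proj₂)
open import Data.Sum.Base using (_⊎_; inj₁; inj₂)
import Data.Sum.Base as Sum
open import Function.Base using (_∘_; _on_)
open import Level using (0ℓ)
open import Relation.Binary.Core using (Rel)
open import Relation.Binary.PropositionalEquality
  using (_≡_; _≢_; _≗_; refl; sym; trans; cong; cong₂; subst; module ≡-Reasoning)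
open import Relation.Nullary using (Dec; yes; no; ¬_; ¬?; contradiction)
open import Relation.Nullary.Decidable using (_×-dec_)
open import Relation.Unary using (Pred; Decidable; _⊆_; _≐_; _∪_; _∩_; _∖_; ⋃)

-- A finite multiset of nonzero integers is a list, considered up to _≈ˢ_.

record 𝒮 : Set where
  constructor ⟪_,_⟫
  field
    terms   : List ℤ
    nonZero : All ℤ.NonZero terms

open 𝒮 public

infix 4 _≈ˢ_ _⊑_

_≈ˢ_ : Rel 𝒮 0ℓ
σ ≈ˢ τ = terms σ ↭ terms τ

occurrences : ℤ → List ℤ → ℕ
occurrences z xs = length (filter (ℤ._≟ z) xs)

_⊑_ : Rel 𝒮 0ℓ
σ ⊑ τ = ∀ z → occurrences z (terms σ) ≤ occurrences z (terms τ)

-- The largest absolute value (0 for the empty sequence).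
n₁ : 𝒮 → ℕ
n₁ σ = max 0 (map ∣_∣ (terms σ))

p₁ m₁ : 𝒮 → ℕ
p₁ σ = occurrences (+ n₁ σ) (terms σ)
m₁ σ = occurrences (- (+ n₁ σ)) (terms σ)

𝒮₀ : Pred 𝒮 0ℓ
𝒮₀ σ = 0 < p₁ σ × 0 < m₁ σ

𝒮₀? : Decidable 𝒮₀
𝒮₀? σ = (0 ℕ.<? p₁ σ) ×-dec (0 ℕ.<? m₁ σ)

occurs⇒nonZero : ∀ {z xs} → All ℤ.NonZero xs → 0 < occurrences z xs → ℤ.NonZero z
occurs⇒nonZero {z} {x ∷ xs} (px ∷ pxs) 0<occ with x ℤ.≟ z
... | yes refl = px
... | no x≢z   = occurs⇒nonZero pxs 0<occ

n₁-nonZero : ∀ σ → 𝒮₀ σ → ℕ.NonZero (n₁ σ)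
n₁-nonZero σ (0<p₁ , _) = occurs⇒nonZero {+ n₁ σ} (nonZero σ) 0<p₁

lower : ℕ → List ℤ → List ℤ
lower n = filter (λ z → ¬? (∣ z ∣ ℕ.≟ n))

-- Replaces the pair (p₁ , m₁) by (p , m).  When (p , m) is (0 , 0) no term of
-- absolute value n₁ is left, so the pair disappears and the next one becomes
-- the first.
setPair : (σ : 𝒮) → 𝒮₀ σ → ℕ × ℕ → 𝒮
setPair σ σ∈𝒮₀ (p , m) =
  ⟪ replicate p (+ n) ++ replicate m (- (+ n)) ++ lower n (terms σ)
  , All.++⁺ (All.replicate⁺ p n≢0)
      (All.++⁺ (All.replicate⁺ m (subst ℕ.NonZero (sym (ℤ.∣-i∣≡∣i∣ (+ n))) n≢0))
        (All.filter⁺ _ (nonZero σ)))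
  ⟫
  where
  n   = n₁ σ
  n≢0 = n₁-nonZero σ σ∈𝒮₀

data Letter : Set where
  ρ₁ ρ₂ ρ₃ : Letter

newPair : Letter → ℕ → ℕ → ℕ × ℕ
newPair ρ₁ p m = 1 , m
newPair ρ₂ p m = p , 1
newPair ρ₃ p m = p ∸ (p ⊓ m) , m ∸ (p ⊓ m)

actIf : Letter → (σ : 𝒮) → Dec (𝒮₀ σ) → 𝒮
actIf ρ σ (yes σ∈𝒮₀) = setPair σ σ∈𝒮₀ (newPair ρ (p₁ σ) (m₁ σ))
actIf ρ σ (no  _)    = σ

act : Letter → 𝒮 → 𝒮
act ρ σ = actIf ρ σ (𝒮₀? σ)

apply : List Letter → 𝒮 → 𝒮
apply w σ = foldl (λ τ ρ → act ρ τ) σ w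

-- The pair (a , b) stands for the factor ρ₁ᵃρ₂ᵇρ₃.
Exponents : Set
Exponents = Bool × Bool

𝟙𝟙 : Exponents
𝟙𝟙 = true , true

optional : Exponents → List Letter
optional (a , b) = (if a then ρ₁ ∷ [] else []) ++ (if b then ρ₂ ∷ [] else [])

factor : Exponents → List Letter
factor ab = optional ab ++ ρ₃ ∷ []

-- An infinite word T₁T₂⋯ is given by its sequence of factors; the factor Tᵢ is
-- stored at index i ∸ 1.
ℛ₁₂₃ : Set
ℛ₁₂₃ = ℕ → Exponents

prefix : ℛ₁₂₃ → ℕ → List Letter
prefix T k = concatMap factor (applyUpTo T k)

-- Every letter only deletes terms, so it is enough to look at the prefixes
-- made of complete factors.
EventualValue : ℛ₁₂₃ → 𝒮 → 𝒮 → Set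
EventualValue T σ τ = ∃ λ N → ∀ k → N ≤ k → apply (prefix T k) σ ≈ˢ τ

actIf-inert : ∀ ρ {σ} d → ¬ 𝒮₀ σ → actIf ρ σ d ≡ σ
actIf-inert ρ (yes σ∈𝒮₀) σ∉𝒮₀ = contradiction σ∈𝒮₀ σ∉𝒮₀
actIf-inert ρ (no  _)    σ∉𝒮₀ = refl

act-inert : ∀ ρ {σ} → ¬ 𝒮₀ σ → act ρ σ ≡ σ
act-inert ρ {σ} = actIf-inert ρ (𝒮₀? σ)

apply-inert : ∀ w {σ} → ¬ 𝒮₀ σ → apply w σ ≡ σ
apply-inert []      σ∉𝒮₀ = refl
apply-inert (ρ ∷ w) σ∉𝒮₀ = trans (cong (apply w) (act-inert ρ σ∉𝒮₀)) (apply-inert w σ∉𝒮₀)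

size : 𝒮 → ℕ
size = length ∘ terms

+n≢-n : ∀ n → ℕ.NonZero n → + n ≢ - (+ n)
+n≢-n (suc n) _ ()

pair-size : ∀ n → ℕ.NonZero n → ∀ xs →
            (occurrences (+ n) xs + occurrences (- (+ n)) xs) + length (lower n xs) ≤ length xs
pair-size n n≢0 [] = z≤n
pair-size n n≢0 (x ∷ xs) = split (x ℤ.≟ + n) (x ℤ.≟ - (+ n)) (∣ x ∣ ℕ.≟ n)
  where
  P? = ℤ._≟ + n
  M? = ℤ._≟ - (+ n)
  L? = λ z → ¬? (∣ z ∣ ℕ.≟ n)
  ps = occurrences (+ n) xs
  ms = occurrences (- (+ n)) xs
  ih = pair-size n n≢0 xs

  split : Dec (x ≡ + n) → Dec (x ≡ - (+ n)) → Dec (∣ x ∣ ≡ n) →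
          (occurrences (+ n) (x ∷ xs) + occurrences (- (+ n)) (x ∷ xs)) +
          length (lower n (x ∷ xs)) ≤ suc (length xs)
  split (yes p) (yes m) _ = contradiction (trans (sym p) m) (+n≢-n n n≢0)
  split (yes p) (no ¬m) _
    rewrite filter-accept P? {x} {xs} p | filter-reject M? {x} {xs} ¬m
          | filter-reject L? {x} {xs} (λ ¬l → ¬l (cong ∣_∣ p)) = s≤s ih
  split (no ¬p) (yes m) _
    rewrite filter-reject P? {x} {xs} ¬p | filter-accept M? {x} {xs} m
          | filter-reject L? {x} {xs} (λ ¬l → ¬l (trans (cong ∣_∣ m) (ℤ.∣-i∣≡∣i∣ (+ n))))
          | ℕ.+-suc ps ms = s≤s ih
  split (no ¬p) (no ¬m) (yes l)
    rewrite filter-reject P? {x} {xs} ¬p | filter-reject M? {x} {xs} ¬m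
          | filter-reject L? {x} {xs} (λ ¬l → ¬l l) = ℕ.m≤n⇒m≤1+n ih
  split (no ¬p) (no ¬m) (no ¬l)
    rewrite filter-reject P? {x} {xs} ¬p | filter-reject M? {x} {xs} ¬m
          | filter-accept L? {x} {xs} ¬l
          | ℕ.+-suc (ps + ms) (length (lower n xs)) = s≤s ih

total : ℕ × ℕ → ℕ
total (p , m) = p + m

size-setPair : ∀ σ s pm → size (setPair σ s pm) ≡ total pm + length (lower (n₁ σ) (terms σ))
size-setPair σ s (p , m) = begin
  length (ps ++ ms ++ ls)               ≡⟨ length-++ ps ⟩
  length ps + length (ms ++ ls)         ≡⟨ cong (λ j → length ps + j) (length-++ ms) ⟩
  length ps + (length ms + length ls)   ≡⟨ cong₂ (λ i j → i + (j + length ls))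
                                                 (length-replicate p) (length-replicate m) ⟩
  p + (m + length ls)                   ≡⟨ ℕ.+-assoc p m (length ls) ⟨
  (p + m) + length ls                   ∎
  where
  open ≡-Reasoning
  ps = replicate p (+ n₁ σ)
  ms = replicate m (- (+ n₁ σ))
  ls = lower (n₁ σ) (terms σ)

total-newPair : ∀ ρ p m → 0 < p → 0 < m → total (newPair ρ p m) ≤ p + m
total-newPair ρ₁ p m 0<p 0<m = ℕ.+-monoˡ-≤ m 0<p
total-newPair ρ₂ p m 0<p 0<m = ℕ.+-monoʳ-≤ p 0<m
total-newPair ρ₃ p m 0<p 0<m = ℕ.+-mono-≤ (ℕ.m∸n≤m p (p ⊓ m)) (ℕ.m∸n≤m m (p ⊓ m))

total-newPair-ρ₃ : ∀ p m → 0 < p → 0 < m → total (newPair ρ₃ p m) < p + m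
total-newPair-ρ₃ (suc p) (suc m) _ _ =
  ℕ.+-mono-<-≤ (s≤s (ℕ.m∸n≤m p (p ⊓ m))) (ℕ.m∸n≤m (suc m) (suc (p ⊓ m)))

size-actIf : ∀ ρ σ d → size (actIf ρ σ d) ≤ size σ
size-actIf ρ σ (no _) = ℕ.≤-refl
size-actIf ρ σ (yes s) = ℕ.≤-trans
  (ℕ.≤-reflexive (size-setPair σ s (newPair ρ (p₁ σ) (m₁ σ))))
  (ℕ.≤-trans
    (ℕ.+-monoˡ-≤ (length (lower (n₁ σ) (terms σ)))
      (total-newPair ρ (p₁ σ) (m₁ σ) (proj₁ s) (proj₂ s)))
    (pair-size (n₁ σ) (n₁-nonZero σ s) (terms σ)))

size-act : ∀ ρ σ → size (act ρ σ) ≤ size σ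
size-act ρ σ = size-actIf ρ σ (𝒮₀? σ)

ρ₃-progressIf : ∀ σ d → ¬ 𝒮₀ (actIf ρ₃ σ d) ⊎ size (actIf ρ₃ σ d) < size σ
ρ₃-progressIf σ (no σ∉𝒮₀) = inj₁ σ∉𝒮₀
ρ₃-progressIf σ (yes s) = inj₂ (ℕ.≤-<-trans
  (ℕ.≤-reflexive (size-setPair σ s (newPair ρ₃ (p₁ σ) (m₁ σ))))
  (ℕ.<-≤-trans
    (ℕ.+-monoˡ-< (length (lower (n₁ σ) (terms σ)))
      (total-newPair-ρ₃ (p₁ σ) (m₁ σ) (proj₁ s) (proj₂ s)))
    (pair-size (n₁ σ) (n₁-nonZero σ s) (terms σ))))

size-apply : ∀ w σ → size (apply w σ) ≤ size σ
size-apply []      σ = ℕ.≤-refl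
size-apply (ρ ∷ w) σ = ℕ.≤-trans (size-apply w (act ρ σ)) (size-act ρ σ)

apply-++ : ∀ v w σ → apply (v ++ w) σ ≡ apply w (apply v σ)
apply-++ v w σ = foldl-++ _ σ v w

factor-progress : ∀ ab σ → ¬ 𝒮₀ (apply (factor ab) σ) ⊎ size (apply (factor ab) σ) < size σ
factor-progress ab σ =
  subst (λ υ → ¬ 𝒮₀ υ ⊎ size υ < size σ) (sym (apply-++ (optional ab) (ρ₃ ∷ []) σ))
    (Sum.map₂ (λ smaller → ℕ.<-≤-trans smaller (size-apply (optional ab) σ))
      (ρ₃-progressIf τ (𝒮₀? τ)))
  where τ = apply (optional ab) σ

apply-prefix : ∀ T k σ → apply (prefix T (suc k)) σ ≡
                         apply (prefix (T ∘ suc) k) (apply (factor (T 0)) σ)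
apply-prefix T k σ = apply-++ (factor (T 0)) (prefix (T ∘ suc) k) σ

eventual-inert : ∀ T σ → ¬ 𝒮₀ (apply (factor (T 0)) σ) →
                 EventualValue T σ (apply (factor (T 0)) σ)
eventual-inert T σ inert = 1 , stable
  where
  stable : ∀ k → 1 ≤ k → apply (prefix T k) σ ≈ˢ apply (factor (T 0)) σ
  stable (suc k) _ = ↭-reflexive (cong terms
    (trans (apply-prefix T k σ) (apply-inert (prefix (T ∘ suc) k) inert)))

eventual-suc : ∀ T σ τ → EventualValue (T ∘ suc) (apply (factor (T 0)) σ) τ → EventualValue T σ τ
eventual-suc T σ τ (N , stable) = suc N , stable′
  where
  stable′ : ∀ k → suc N ≤ k → apply (prefix T k) σ ≈ˢ τ
  stable′ (suc k) (s≤s N≤k) = subst (_≈ˢ τ) (sym (apply-prefix T k σ)) (stable k N≤k)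

eventualValue-bounded : ∀ b T σ → size σ ≤ b → ∃ (EventualValue T σ)
eventualValue-step : ∀ b T σ → size σ ≤ b →
  ¬ 𝒮₀ (apply (factor (T 0)) σ) ⊎ size (apply (factor (T 0)) σ) < size σ →
  ∃ (EventualValue T σ)

eventualValue-bounded b T σ σ≤b = eventualValue-step b T σ σ≤b (factor-progress (T 0) σ)

eventualValue-step b T σ σ≤b (inj₁ inert) =
  apply (factor (T 0)) σ , eventual-inert T σ inert
eventualValue-step zero T σ σ≤b (inj₂ smaller) = contradiction (ℕ.<-≤-trans smaller σ≤b) λ ()
eventualValue-step (suc b) T σ σ≤b (inj₂ smaller) =
  let τ , ev = eventualValue-bounded b (T ∘ suc) (apply (factor (T 0)) σ)
                 (s≤s⁻¹ (ℕ.<-≤-trans smaller σ≤b))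
  in  τ , eventual-suc T σ τ ev

opaque

  eventualValue : ∀ T σ → ∃ (EventualValue T σ)
  eventualValue T σ = eventualValue-bounded (size σ) T σ ℕ.≤-refl

infixl 9 _·_

_·_ : ℛ₁₂₃ → 𝒮 → 𝒮
T · σ = proj₁ (eventualValue T σ)

infix 4 _≼_

_≼_ : Rel ℛ₁₂₃ 0ℓ
T ≼ T′ = ∀ σ → T · σ ⊑ T′ · σ

⟨·⟩₌ : ℛ₁₂₃
⟨·⟩₌ _ = 𝟙𝟙

Interval : ℛ₁₂₃ → ℛ₁₂₃ → Set
Interval U R = ∃ λ T → U ≼ T × T ≼ R

module _ {U R : ℛ₁₂₃} where

  infix 4 _≈ᴵ_ _≼ᴵ_

  -- Distinct sequences of factors are distinct rules.
  _≈ᴵ_ : Rel (Interval U R) 0ℓ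
  _≈ᴵ_ = _≗_ on proj₁

  _≼ᴵ_ : Rel (Interval U R) 0ℓ
  _≼ᴵ_ = _≼_ on proj₁

𝓘 : ℛ₁₂₃ → Exponents → Pred ℕ 0ℓ
𝓘 T ab i = T i ≡ ab

infixr 6 _⊕_

_⊕_ : Pred ℕ 0ℓ → Pred ℕ 0ℓ → Pred ℕ 0ℓ
P ⊕ Q = (P ∖ Q) ∪ (Q ∖ P)

Non𝟙𝟙 : Set
Non𝟙𝟙 = ∃ λ ab → ab ≢ 𝟙𝟙

MeetFormula JoinFormula : ℛ₁₂₃ → ℛ₁₂₃ → ℛ₁₂₃ → Set
MeetFormula T T′ S =
  (𝓘 S 𝟙𝟙 ≐ 𝓘 T 𝟙𝟙 ∪ 𝓘 T′ 𝟙𝟙 ∪ ⋃ Non𝟙𝟙 (λ (ab , _) → 𝓘 T ab ⊕ 𝓘 T′ ab)) ×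
  (∀ ab → ab ≢ 𝟙𝟙 → 𝓘 S ab ≐ 𝓘 T ab ∩ 𝓘 T′ ab)
JoinFormula T T′ S =
  (𝓘 S 𝟙𝟙 ≐ 𝓘 T 𝟙𝟙 ∩ 𝓘 T′ 𝟙𝟙) ×
  (∀ ab → ab ≢ 𝟙𝟙 → 𝓘 S ab ≐ 𝓘 T ab ∪ 𝓘 T′ ab)

support : ℛ₁₂₃ → Pred ℕ 0ℓ
support R = ⋃ Non𝟙𝟙 (λ (ab , _) → 𝓘 R ab)

𝒫 : Pred ℕ 0ℓ → Set₁
𝒫 A = Σ (Pred ℕ 0ℓ) λ P → P ⊆ A

-- Since the factors of a rule are given by a function, an index set is always
-- decidable.  Under excluded middle, 𝒫ᵈ A and 𝒫 A have the same elements.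
𝒫ᵈ : Pred ℕ 0ℓ → Set₁
𝒫ᵈ A = ∃ λ ((P , _) : 𝒫 A) → Decidable P

module _ {A : Pred ℕ 0ℓ} where

  infix 4 _≐ᴾ_ _⊆ᴾ_ _≐ᵈ_ _⊆ᵈ_

  _≐ᴾ_ _⊆ᴾ_ : Rel (𝒫 A) 0ℓ
  _≐ᴾ_ = _≐_ on proj₁
  _⊆ᴾ_ = _⊆_ on proj₁

  _≐ᵈ_ _⊆ᵈ_ : Rel (𝒫ᵈ A) 0ℓ
  _≐ᵈ_ = _≐ᴾ_ on proj₁
  _⊆ᵈ_ = _⊆ᴾ_ on proj₁

{-# OPTIONS --safe #-}
module Submission where

-- A factor applied to a leading pair (p , m) leaves (0 , 0), which lets the next
-- factor act, or a pair with exactly one zero, which stops the word; the factor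
-- ρ₁ρ₂ρ₃ always leaves (0 , 0).  Since the remaining factors only delete terms,
-- replacing factors of T′ by ρ₁ρ₂ρ₃ gives a smaller word.  Conversely, below i
-- pairs (1 , 1) the factor of index i meets an arbitrary pair, and the pairs
-- (2 , 3) and (3 , 2) tell the factors other than ρ₁ρ₂ρ₃ apart.  So T ≼ T′ holds
-- iff each factor of T is ρ₁ρ₂ρ₃ or the factor of T′ of the same index, and an
-- element of [⟨·⟩₌ , R] is R restricted to a subset of support R.

open import Defs
open import Algebra.Core using (Op₂)
open import Axiom.ExcludedMiddle using (ExcludedMiddle)
open import Data.Bool.Base using (true; false)
import Data.Bool.Properties as Bool
open import Data.Integer.Base using (ℤ; +_; -[1+_]; -_; ∣_∣)
import Data.Integer.Base as ℤ
import Data.Integer.Properties as ℤ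
open import Data.List.Base using (List; []; _∷_; _++_; length; map; filter; replicate; foldl)
open import Data.List.Extrema.Nat using (max; max≈v⁺; xs≤max)
open import Data.List.Membership.Propositional using (_∈_)
open import Data.List.Properties
  using (length-++; length-replicate; filter-++; filter-all; filter-none)
open import Data.List.Relation.Binary.Permutation.Propositional using (_↭_)
open import Data.List.Relation.Binary.Permutation.Propositional.Properties using (↭-length; filter-↭)
open import Data.List.Relation.Unary.All using (All; [])
import Data.List.Relation.Binary.Sublist.Propositional.Properties as Sublist
import Data.List.Relation.Unary.All as All
import Data.List.Relation.Unary.All.Properties as All
open import Data.List.Relation.Unary.Any using (here)
open import Data.Nat.Base using (ℕ; zero; suc; _+_; _∸_; _⊓_; _⊔_; _≤_; _<_; z≤n; s≤s; z<s)
import Data.Nat.Base as ℕ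
import Data.Nat.Properties as ℕ
open import Data.Product.Base using (Σ; Σ-syntax; ∃; _×_; _,_; proj₁; proj₂)
import Data.Product.Properties as Product
open import Data.Sum.Base using (_⊎_; inj₁; inj₂; [_,_]′)
open import Function.Base using (_∘_; _$_; id)
open import Level using (0ℓ)
open import Relation.Binary.Definitions using (DecidableEquality)
open import Relation.Binary.Lattice.Structures using (IsLattice)
open import Relation.Binary.Morphism.Structures using (IsOrderIsomorphism)
open import Relation.Binary.PropositionalEquality
  using (_≡_; _≢_; _≗_; refl; sym; ≢-sym; trans; cong; cong₂; subst; subst₂; module ≡-Reasoning)
open import Relation.Nullary using (Dec; yes; no; ¬_; ¬?; contradiction)
open import Relation.Unary using (Pred; Decidable; _⊆_)

-- Equality in `𝒮` and occurrence counts

nonZero-irrelevant : ∀ {z} (p q : ℤ.NonZero z) → p ≡ q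
nonZero-irrelevant {+ suc _}   _ _ = refl
nonZero-irrelevant { -[1+ _ ]} _ _ = refl

-- Nonzeroness proofs are irrelevant. Two results with the same list can thus be identified
-- outright, and the rest of a word applied to both.
terms-injective : ∀ {σ τ} → terms σ ≡ terms τ → σ ≡ τ
terms-injective {⟪ xs , p ⟫} {⟪ .xs , q ⟫} refl =
  cong ⟪ xs ,_⟫ (All.irrelevant (λ {z} → nonZero-irrelevant {z}) p q)

occurrences-++ : ∀ z xs ys → occurrences z (xs ++ ys) ≡ occurrences z xs + occurrences z ys
occurrences-++ z xs ys = trans (cong length (filter-++ (ℤ._≟ z) xs ys)) (length-++ (filter (ℤ._≟ z) xs))

occurrences-all : ∀ {z xs} → All (_≡ z) xs → occurrences z xs ≡ length xs
occurrences-all xs≡z = cong length (filter-all _ xs≡z)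

occurrences-none : ∀ {z xs} → All (_≢ z) xs → occurrences z xs ≡ 0
occurrences-none xs≢z = cong length (filter-none _ xs≢z)

occurrences-↭ : ∀ z {xs ys} → xs ↭ ys → occurrences z xs ≡ occurrences z ys
occurrences-↭ z xs↭ys = ↭-length (filter-↭ (ℤ._≟ z) xs↭ys)

occurrences-lower : ∀ z n xs → occurrences z (lower n xs) ≤ occurrences z xs
occurrences-lower z n xs = Sublist.length-mono-≤
  (Sublist.filter⁺ (ℤ._≟ z) (ℤ._≟ z) (λ { refl eq → eq }) (Sublist.filter-⊆ _ xs))

-- A leading pair above terms of smaller absolute value

Below : ℕ → List ℤ → Set
Below n = All (λ z → ∣ z ∣ < n)

-- This is literally the list built by `setPair`, so the result of a letter is a block by
-- computation.
block : ℕ → ℕ × ℕ → List ℤ → List ℤ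
block n (p , m) xs = replicate p (+ n) ++ replicate m (- (+ n)) ++ xs

abs-neg : ∀ n → ∣ - (+ n) ∣ ≡ n
abs-neg n = ℤ.∣-i∣≡∣i∣ (+ n)

occurrences-block : ∀ z n p m xs → occurrences z (block n (p , m) xs) ≡
  occurrences z (replicate p (+ n)) + (occurrences z (replicate m (- (+ n))) + occurrences z xs)
occurrences-block z n p m xs = trans (occurrences-++ z (replicate p (+ n)) _)
  (cong (λ k → _ + k) (occurrences-++ z (replicate m (- (+ n))) xs))

occurrences-replicate : ∀ z p → occurrences z (replicate p z) ≡ p
occurrences-replicate z p = trans (occurrences-all (All.replicate⁺ p refl)) (length-replicate p)

occurrences-replicate-≢ : ∀ {y z} p → y ≢ z → occurrences z (replicate p y) ≡ 0
occurrences-replicate-≢ p y≢z = occurrences-none (All.replicate⁺ p y≢z)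

occurrences-below : ∀ {z n xs} → ∣ z ∣ ≡ n → Below n xs → occurrences z xs ≡ 0
occurrences-below refl xs<n =
  occurrences-none (All.map (λ x<n x≡z → ℕ.<⇒≢ x<n (cong ∣_∣ x≡z)) xs<n)

module _ {n p m : ℕ} {xs : List ℤ} (n≢0 : ℕ.NonZero n) (xs<n : Below n xs) where

  occurrences-block-+ : occurrences (+ n) (block n (p , m) xs) ≡ p
  occurrences-block-+ = trans (occurrences-block (+ n) n p m xs) (trans
    (cong₂ _+_ (occurrences-replicate (+ n) p)
      (cong₂ _+_ (occurrences-replicate-≢ m (≢-sym (+n≢-n n n≢0))) (occurrences-below refl xs<n)))
    (ℕ.+-identityʳ p))

  occurrences-block-- : occurrences (- (+ n)) (block n (p , m) xs) ≡ m
  occurrences-block-- = trans (occurrences-block (- (+ n)) n p m xs) (trans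
    (cong₂ _+_ (occurrences-replicate-≢ p (+n≢-n n n≢0))
      (cong₂ _+_ (occurrences-replicate (- (+ n)) m) (occurrences-below (abs-neg n) xs<n)))
    (ℕ.+-identityʳ m))

occurrences-block-≢ : ∀ {z n} p m xs → ∣ z ∣ ≢ n →
  occurrences z (block n (p , m) xs) ≡ occurrences z xs
occurrences-block-≢ {z} {n} p m xs ∣z∣≢n = trans (occurrences-block z n p m xs)
  (cong₂ (λ i j → i + (j + occurrences z xs))
    (occurrences-replicate-≢ p λ eq → ∣z∣≢n (sym (cong ∣_∣ eq)))
    (occurrences-replicate-≢ m λ eq → ∣z∣≢n (trans (sym (cong ∣_∣ eq)) (abs-neg n))))

lower-block : ∀ n p m {xs} → Below n xs → lower n (block n (p , m) xs) ≡ xs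
lower-block n p m {xs} xs<n = begin
  lower n (ps ++ ms ++ xs)               ≡⟨ filter-++ L? ps (ms ++ xs) ⟩
  lower n ps ++ lower n (ms ++ xs)       ≡⟨ cong (lower n ps ++_) (filter-++ L? ms xs) ⟩
  lower n ps ++ lower n ms ++ lower n xs ≡⟨ cong₂ (λ as bs → as ++ bs ++ lower n xs)
                                              (filter-none L? (All.replicate⁺ p (_$ refl)))
                                              (filter-none L? (All.replicate⁺ m (_$ abs-neg n))) ⟩
  lower n xs                             ≡⟨ filter-all L? (All.map ℕ.<⇒≢ xs<n) ⟩
  xs                                     ∎
  where
  open ≡-Reasoning
  L? = λ z → ¬? (∣ z ∣ ℕ.≟ n)
  ps = replicate p (+ n)
  ms = replicate m (- (+ n))

n₁-block : ∀ n p m {xs} → Below n xs → 0 < p + m → max 0 (map ∣_∣ (block n (p , m) xs)) ≡ n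
n₁-block n p m {xs} xs<n 0<p+m = max≈v⁺ (n∈ p m 0<p+m)
  (All.map⁺ (All.++⁺ (All.replicate⁺ p ℕ.≤-refl)
    (All.++⁺ (All.replicate⁺ m (ℕ.≤-reflexive (abs-neg n))) (All.map ℕ.<⇒≤ xs<n)))) z≤n
  where
  n∈ : ∀ p m → 0 < p + m → n ∈ map ∣_∣ (block n (p , m) xs)
  n∈ (suc p) m       _ = here refl
  n∈ zero    (suc m) _ = here (sym (abs-neg n))

lower-below : ∀ σ → Below (n₁ σ) (lower (n₁ σ) (terms σ))
lower-below σ = All.zipWith (λ (x≤n , x≢n) → ℕ.≤∧≢⇒< x≤n x≢n)
  ( All.filter⁺ L? (All.map⁻ (xs≤max 0 (map ∣_∣ (terms σ))))
  , All.all-filter L? (terms σ))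
  where L? = λ z → ¬? (∣ z ∣ ℕ.≟ n₁ σ)

-- Letters and factors acting on the leading pair

-- Stated by equations because an arbitrary element of `𝒮₀` need not list its terms as a block; the
-- action of a letter depends on these data alone.
record LedBy (σ : 𝒮) (n : ℕ) (pm : ℕ × ℕ) (xs : List ℤ) : Set where
  constructor led
  field
    n₁≡    : n₁ σ ≡ n
    p₁≡    : p₁ σ ≡ proj₁ pm
    m₁≡    : m₁ σ ≡ proj₂ pm
    lower≡ : lower (n₁ σ) (terms σ) ≡ xs

block-led : ∀ {σ n p m xs} → ℕ.NonZero n → Below n xs → 0 < p + m →
            terms σ ≡ block n (p , m) xs → LedBy σ n (p , m) xs
block-led {n = n} {p} {m} n≢0 xs<n 0<p+m eq = led n₁≡
  (trans (cong₂ (λ k → occurrences (+ k)) n₁≡ eq) (occurrences-block-+ {m = m} n≢0 xs<n))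
  (trans (cong₂ (λ k → occurrences (- (+ k))) n₁≡ eq) (occurrences-block-- {p = p} n≢0 xs<n))
  (trans (cong₂ lower n₁≡ eq) (lower-block n p m xs<n))
  where n₁≡ = trans (cong (max 0 ∘ map ∣_∣) eq) (n₁-block n p m xs<n 0<p+m)

terms-actIf : ∀ ρ σ d → 𝒮₀ σ → terms (actIf ρ σ d) ≡
              block (n₁ σ) (newPair ρ (p₁ σ) (m₁ σ)) (lower (n₁ σ) (terms σ))
terms-actIf ρ σ (yes _)    _ = refl
terms-actIf ρ σ (no σ∉𝒮₀) σ∈𝒮₀ = contradiction σ∈𝒮₀ σ∉𝒮₀

terms-act : ∀ ρ {σ n p m xs} → LedBy σ n (suc p , suc m) xs →
            terms (act ρ σ) ≡ block n (newPair ρ (suc p) (suc m)) xs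
terms-act ρ {σ} (led refl p₁≡ m₁≡ refl) = trans
  (terms-actIf ρ σ (𝒮₀? σ) (subst (0 <_) (sym p₁≡) z<s , subst (0 <_) (sym m₁≡) z<s))
  (cong₂ (λ p m → block (n₁ σ) (newPair ρ p m) (lower (n₁ σ) (terms σ))) p₁≡ m₁≡)

-- Folding `newPair` without testing for zeros is faithful on positive pairs: ρ₁ and ρ₂ keep both
-- entries positive, and ρ₃ comes last.
factorPair : Exponents → ℕ × ℕ → ℕ × ℕ
factorPair ab pm = foldl (λ (p , m) ρ → newPair ρ p m) pm (factor ab)

module _ {n : ℕ} {xs : List ℤ} (n≢0 : ℕ.NonZero n) (xs<n : Below n xs) where

  private
    led′ : ∀ {σ p m} → terms σ ≡ block n (suc p , suc m) xs → LedBy σ n (suc p , suc m) xs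
    led′ = block-led n≢0 xs<n z<s

  terms-factor : ∀ ab {σ p m} → LedBy σ n (suc p , suc m) xs →
    terms (apply (factor ab) σ) ≡ block n (factorPair ab (suc p , suc m)) xs
  terms-factor (false , false) l = terms-act ρ₃ l
  terms-factor (true  , false) {σ} {p} {m} l =
    terms-act ρ₃ {act ρ₁ σ} {n} {0} {m} (led′ {act ρ₁ σ} (terms-act ρ₁ {σ} l))
  terms-factor (false , true)  {σ} {p} {m} l =
    terms-act ρ₃ {act ρ₂ σ} {n} {p} {0} (led′ {act ρ₂ σ} (terms-act ρ₂ {σ} l))
  terms-factor (true  , true)  {σ} {p} {m} l =
    terms-act ρ₃ {act ρ₂ τ} {n} {0} {0} (led′ {act ρ₂ τ} (terms-act ρ₂ {τ} {n} {0} {m}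
      (led′ {τ} (terms-act ρ₁ {σ} l))))
    where τ = act ρ₁ σ

  -- If both entries are zero the block vanishes. If only one is, then `p₁` or `m₁` is zero and no
  -- letter acts any more.
  inert-block : ∀ {σ p m} → p ≡ 0 ⊎ m ≡ 0 → terms σ ≡ block n (p , m) xs →
                terms σ ≡ xs ⊎ ¬ 𝒮₀ σ
  inert-block {p = zero}  {zero}  _ eq = inj₁ eq
  inert-block {σ} {zero}  {suc m} _ eq = inj₂ λ (0<p₁ , _) →
    ℕ.<⇒≢ 0<p₁ (sym (LedBy.p₁≡ (block-led {σ} n≢0 xs<n z<s eq)))
  inert-block {σ} {suc p} {zero}  _ eq = inj₂ λ (_ , 0<m₁) →
    ℕ.<⇒≢ 0<m₁ (sym (LedBy.m₁≡ (block-led {σ} n≢0 xs<n z<s eq)))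
  inert-block {p = suc p} {suc m} (inj₁ ())
  inert-block {p = suc p} {suc m} (inj₂ ())

-- The final ρ₃ subtracts the minimum of the two entries, which is one of them.
factorPair-zero : ∀ ab p m → let pm = factorPair ab (suc p , suc m) in proj₁ pm ≡ 0 ⊎ proj₂ pm ≡ 0
factorPair-zero (true  , true)  p m = inj₁ refl
factorPair-zero (true  , false) p m = inj₁ refl
factorPair-zero (false , true)  p m = inj₂ (ℕ.0∸n≡0 (p ⊓ 0))
factorPair-zero (false , false) p m with ℕ.⊓-sel p m
... | inj₁ eq = inj₁ (trans (cong (p ∸_) eq) (ℕ.n∸n≡0 p))
... | inj₂ eq = inj₂ (trans (cong (m ∸_) eq) (ℕ.n∸n≡0 m))

led-self : ∀ {σ} → 𝒮₀ σ → ∃ λ p → ∃ λ m →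
           LedBy σ (n₁ σ) (suc p , suc m) (lower (n₁ σ) (terms σ))
led-self {σ} (0<p₁ , 0<m₁) = _ , _ ,
  led refl (sym (ℕ.suc-pred (p₁ σ) {{ℕ.>-nonZero 0<p₁}}))
           (sym (ℕ.suc-pred (m₁ σ) {{ℕ.>-nonZero 0<m₁}})) refl

-- Letters only delete terms

block-mono : ∀ {n p m q l} xs → p ≤ q → m ≤ l → ∀ z →
             occurrences z (block n (p , m) xs) ≤ occurrences z (block n (q , l) xs)
block-mono {n} {p} {m} {q} {l} xs p≤q m≤l z
  rewrite occurrences-block z n p m xs | occurrences-block z n q l xs =
  ℕ.+-mono-≤ (rep p≤q) (ℕ.+-monoˡ-≤ _ (rep m≤l))
  where
  rep : ∀ {y a b} → a ≤ b → occurrences z (replicate a y) ≤ occurrences z (replicate b y)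
  rep {y} {a} {b} a≤b with y ℤ.≟ z
  ... | yes refl rewrite occurrences-replicate y a | occurrences-replicate y b = a≤b
  ... | no  y≢z  rewrite occurrences-replicate-≢ {y} {z} a y≢z = z≤n

newPair-≤ : ∀ ρ {p m} → 0 < p → 0 < m → proj₁ (newPair ρ p m) ≤ p × proj₂ (newPair ρ p m) ≤ m
newPair-≤ ρ₁ 0<p 0<m = 0<p , ℕ.≤-refl
newPair-≤ ρ₂ 0<p 0<m = ℕ.≤-refl , 0<m
newPair-≤ ρ₃ {p} {m} 0<p 0<m = ℕ.m∸n≤m p (p ⊓ m) , ℕ.m∸n≤m m (p ⊓ m)

abs≡⇒ : ∀ z {n} → ∣ z ∣ ≡ n → z ≡ + n ⊎ z ≡ - (+ n)
abs≡⇒ (+ n)    refl = inj₁ refl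
abs≡⇒ -[1+ n ] refl = inj₂ refl

-- The only integers of absolute value `n` are `+ n` and `- (+ n)`, whose multiplicities are kept;
-- all other terms come from the sublist `lower n ys`.
block-⊑ : ∀ n ys → ℕ.NonZero n → Below n (lower n ys) → ∀ z →
  occurrences z (block n (occurrences (+ n) ys , occurrences (- (+ n)) ys) (lower n ys)) ≤
  occurrences z ys
block-⊑ n ys n≢0 <n z = split (∣ z ∣ ℕ.≟ n)
  where
  p = occurrences (+ n) ys
  m = occurrences (- (+ n)) ys
  Goal = λ z → occurrences z (block n (p , m) (lower n ys)) ≤ occurrences z ys
  split : Dec (∣ z ∣ ≡ n) → Goal z
  split (no ∣z∣≢n) = ℕ.≤-trans (ℕ.≤-reflexive (occurrences-block-≢ p m (lower n ys) ∣z∣≢n))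
    (occurrences-lower z n ys)
  split (yes ∣z∣≡n) =
    [ (λ eq → subst Goal (sym eq) (ℕ.≤-reflexive (occurrences-block-+ {m = m} n≢0 <n)))
    , (λ eq → subst Goal (sym eq) (ℕ.≤-reflexive (occurrences-block-- {p = p} n≢0 <n)))
    ]′ (abs≡⇒ z ∣z∣≡n)

actIf-⊑ : ∀ ρ σ d → actIf ρ σ d ⊑ σ
actIf-⊑ ρ σ (no _) z = ℕ.≤-refl
actIf-⊑ ρ σ (yes s) z = let p≤ , m≤ = newPair-≤ ρ (proj₁ s) (proj₂ s) in
  ℕ.≤-trans (block-mono {n = n₁ σ} (lower (n₁ σ) (terms σ)) p≤ m≤ z) (block-⊑ (n₁ σ) (terms σ) (n₁-nonZero σ s) (lower-below σ) z)

apply-⊑ : ∀ w σ → apply w σ ⊑ σ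
apply-⊑ []      σ z = ℕ.≤-refl
apply-⊑ (ρ ∷ w) σ z = ℕ.≤-trans (apply-⊑ w (act ρ σ) z) (actIf-⊑ ρ σ (𝒮₀? σ) z)

-- Replacing factors by ρ₁ρ₂ρ₃ gives a smaller word

block-dichotomy : ∀ {n pm xs} τ υ → terms τ ≡ block n pm xs → terms υ ≡ xs →
                  terms τ ≡ xs ⊎ ¬ 𝒮₀ τ → τ ≡ υ ⊎ (¬ 𝒮₀ τ × υ ⊑ τ)
block-dichotomy τ υ τ≡ υ≡ (inj₁ eq) = inj₁ (terms-injective (trans eq (sym υ≡)))
block-dichotomy {n} {pm} {xs} τ υ τ≡ υ≡ (inj₂ inert) = inj₂ (inert , υ⊑τ)
  where
  υ⊑τ : υ ⊑ τ
  υ⊑τ z = subst₂ (λ xs ys → occurrences z xs ≤ occurrences z ys) (sym υ≡) (sym τ≡)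
    (block-mono {n} {0} {0} {proj₁ pm} {proj₂ pm} xs z≤n z≤n z)

-- The factor ρ₁ρ₂ρ₃ leaves exactly the lower terms. Any other factor either does the same or stops
-- with some leading terms left on top of them.
factor-dichotomy : ∀ ab σ → 𝒮₀ σ → let τ = apply (factor ab) σ ; υ = apply (factor 𝟙𝟙) σ in
                   τ ≡ υ ⊎ (¬ 𝒮₀ τ × υ ⊑ τ)
factor-dichotomy ab σ s = split (led-self {σ} s)
  where
  n≢0 = n₁-nonZero σ s
  xs<n = lower-below σ
  split : (∃ λ p → ∃ λ m → LedBy σ (n₁ σ) (suc p , suc m) (lower (n₁ σ) (terms σ))) → _
  split (p , m , l) =
    block-dichotomy {n₁ σ} {factorPair ab (suc p , suc m)} (apply (factor ab) σ) (apply (factor 𝟙𝟙) σ) τ≡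
      (terms-factor n≢0 xs<n 𝟙𝟙 {σ} {p} {m} l)
      (inert-block n≢0 xs<n {apply (factor ab) σ} (factorPair-zero ab p m) τ≡)
    where τ≡ = terms-factor n≢0 xs<n ab {σ} {p} {m} l

infix 4 _⊴_ _⊴ʳ_

-- The flat order: `𝟙𝟙` is the bottom, and the other three exponents are pairwise incomparable.
_⊴_ : Exponents → Exponents → Set
ab ⊴ cd = ab ≡ 𝟙𝟙 ⊎ ab ≡ cd

_⊴ʳ_ : ℛ₁₂₃ → ℛ₁₂₃ → Set
T ⊴ʳ T′ = ∀ i → T i ⊴ T′ i

module _ (w w′ : List Letter) (w⊑w′ : ∀ σ → apply w σ ⊑ apply w′ σ) where

  -- Letters are not monotone in the sequence: ρ₃ fixes the multiset of 1 alone but empties that of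
  -- 1 and -1. The inclusion survives here because `τ` is inert under `w′`, while `w` can only
  -- delete terms of `υ`.
  apply-dichotomy : ∀ {τ υ} → τ ≡ υ ⊎ (¬ 𝒮₀ τ × υ ⊑ τ) → apply w υ ⊑ apply w′ τ
  apply-dichotomy {τ}     (inj₁ refl) = w⊑w′ τ
  apply-dichotomy {τ} {υ} (inj₂ (inert , υ⊑τ)) =
    subst (apply w υ ⊑_) (sym (apply-inert w′ {τ} inert))
      (λ z → ℕ.≤-trans (apply-⊑ w υ z) (υ⊑τ z))

  factor-mono : ∀ {ab cd} σ → ab ⊴ cd →
                apply w (apply (factor ab) σ) ⊑ apply w′ (apply (factor cd) σ)
  factor-mono {ab} {cd} σ (inj₂ refl) = w⊑w′ (apply (factor ab) σ)
  factor-mono {ab} {cd} σ (inj₁ refl) = split (𝒮₀? σ)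
    where
    split : Dec (𝒮₀ σ) → apply w (apply (factor 𝟙𝟙) σ) ⊑ apply w′ (apply (factor cd) σ)
    split (yes s) = apply-dichotomy {apply (factor cd) σ} {apply (factor 𝟙𝟙) σ}
      (factor-dichotomy cd σ s)
    split (no ¬s) = subst₂ (λ υ τ → apply w υ ⊑ apply w′ τ)
      (sym (apply-inert (factor 𝟙𝟙) {σ} ¬s)) (sym (apply-inert (factor cd) {σ} ¬s)) (w⊑w′ σ)

prefix-mono : ∀ k {T T′} → T ⊴ʳ T′ → ∀ σ → apply (prefix T k) σ ⊑ apply (prefix T′ k) σ
prefix-mono zero             T⊴T′ σ z = ℕ.≤-refl
prefix-mono (suc k) {T} {T′} T⊴T′ σ =
  subst₂ _⊑_ (sym (apply-prefix T k σ)) (sym (apply-prefix T′ k σ))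
    (factor-mono (prefix (T ∘ suc) k) (prefix (T′ ∘ suc) k)
      (prefix-mono k (T⊴T′ ∘ suc)) σ (T⊴T′ 0))

-- Beyond both thresholds the prefixes have reached their values up to permutation, which preserves
-- counts. With `T` equal to `T′` this also compares two eventual values of one word.
eventualValue-⊑ : ∀ {T T′ σ τ τ′} → EventualValue T σ τ → EventualValue T′ σ τ′ →
                  (∀ k → apply (prefix T k) σ ⊑ apply (prefix T′ k) σ) → τ ⊑ τ′
eventualValue-⊑ (N , stable) (N′ , stable′) T⊑T′ z =
  subst₂ _≤_ (occurrences-↭ z (stable _ (ℕ.m≤m⊔n N N′))) (occurrences-↭ z (stable′ _ (ℕ.m≤n⊔m N N′)))
    (T⊑T′ (N ⊔ N′) z)

⊴ʳ⇒≼ : ∀ {T T′} → T ⊴ʳ T′ → T ≼ T′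
⊴ʳ⇒≼ {T} {T′} T⊴T′ σ =
  eventualValue-⊑ {τ = T · σ} {T′ · σ} (proj₂ (eventualValue T σ)) (proj₂ (eventualValue T′ σ))
    (λ k → prefix-mono k T⊴T′ σ)

-- Test sequences that isolate a single factor

-- The pairs of height 2 , … , i + 1 are (1 , 1), which every factor deletes, so
-- that the factor of index i is the one that acts on the pair (p , m).
tower : ℕ → ℕ × ℕ → List ℤ
tower zero    pm = block 1 pm []
tower (suc i) pm = block (suc (suc i)) (1 , 1) (tower i pm)

block-below : ∀ {n p m xs} → Below n xs → Below (suc n) (block n (p , m) xs)
block-below {n} {p} {m} xs<n = All.++⁺ (All.replicate⁺ p ℕ.≤-refl)
  (All.++⁺ (All.replicate⁺ m (s≤s (ℕ.≤-reflexive (abs-neg n)))) (All.map ℕ.m≤n⇒m≤1+n xs<n))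

tower-below : ∀ i pm → Below (suc (suc i)) (tower i pm)
tower-below zero    pm = block-below {p = proj₁ pm} {proj₂ pm} []
tower-below (suc i) pm = block-below {p = 1} {1} (tower-below i pm)

block-nonZero : ∀ {n} p m {xs} → ℕ.NonZero n → All ℤ.NonZero xs → All ℤ.NonZero (block n (p , m) xs)
block-nonZero {n} p m n≢0 xs≢0 = All.++⁺ (All.replicate⁺ p n≢0)
  (All.++⁺ (All.replicate⁺ m (subst ℕ.NonZero (sym (abs-neg n)) n≢0)) xs≢0)

tower-nonZero : ∀ i pm → All ℤ.NonZero (tower i pm)
tower-nonZero zero    (p , m) = block-nonZero p m _ []
tower-nonZero (suc i) pm      = block-nonZero 1 1 _ (tower-nonZero i pm)

towerˢ : ℕ → ℕ × ℕ → 𝒮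
towerˢ i pm = ⟪ tower i pm , tower-nonZero i pm ⟫

factorPair-11 : ∀ ab → factorPair ab (1 , 1) ≡ (0 , 0)
factorPair-11 (true  , true)  = refl
factorPair-11 (true  , false) = refl
factorPair-11 (false , true)  = refl
factorPair-11 (false , false) = refl

factor-tower : ∀ ab i pm → apply (factor ab) (towerˢ (suc i) pm) ≡ towerˢ i pm
factor-tower ab i pm = terms-injective (trans
  (terms-factor _ (tower-below i pm) ab {p = 0} {0}
    (block-led {σ = towerˢ (suc i) pm} {p = 1} {1} _ (tower-below i pm) z<s refl))
  (cong (λ ql → block (suc (suc i)) ql (tower i pm)) (factorPair-11 ab)))

empty-inert : ∀ {σ} → terms σ ≡ [] → ¬ 𝒮₀ σ
empty-inert {⟪ .[] , _ ⟫} refl (() , _)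

-- The chosen value `T · σ` is opaque, so an eventual value with explicit terms is exhibited
-- instead.
Leaves : ℛ₁₂₃ → 𝒮 → ℕ × ℕ → Set
Leaves T σ pm = ∃ λ τ → EventualValue T σ τ × terms τ ≡ block 1 pm []

-- Each factor before index `i` removes the top block, which shifts both the tower and the word. The
-- factor of index `i` then leaves a pair with a zero above nothing, and the word stops.
tower-leaves : ∀ i T p m → Leaves T (towerˢ i (suc p , suc m)) (factorPair (T i) (suc p , suc m))
tower-leaves (suc i) T p m with τ , ev , eq ← tower-leaves i (T ∘ suc) p m =
  τ , eventual-suc T _ τ (subst (λ σ → EventualValue (T ∘ suc) σ τ)
        (sym (factor-tower (T 0) i (suc p , suc m))) ev) , eq
tower-leaves zero    T p m = τ , eventual-inert T σ inert , τ≡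
  where
  σ  = towerˢ 0 (suc p , suc m)
  τ  = apply (factor (T 0)) σ
  τ≡ : terms τ ≡ block 1 (factorPair (T 0) (suc p , suc m)) []
  τ≡ = terms-factor {1} {[]} _ [] (T 0) {σ} {p} {m} (block-led {σ} _ [] z<s refl)
  inert : ¬ 𝒮₀ τ
  inert = [ empty-inert {τ} , id ]′
    (inert-block {1} {[]} _ [] {τ} (factorPair-zero (T 0) p m) τ≡)

factorPair-mono : ∀ {T T′} → T ≼ T′ → ∀ i p m →
  let pm  = factorPair (T i)  (suc p , suc m)
      pm′ = factorPair (T′ i) (suc p , suc m)
  in proj₁ pm ≤ proj₁ pm′ × proj₂ pm ≤ proj₂ pm′
factorPair-mono {T} {T′} T≼T′ i p m
  with τ  , ev  , eq  ← tower-leaves i T  p m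
     | τ′ , ev′ , eq′ ← tower-leaves i T′ p m =
  subst₂ _≤_ (occurrences-block-+ {1} {proj₁ pm} {proj₂ pm} _ [])
             (occurrences-block-+ {1} {proj₁ pm′} {proj₂ pm′} _ []) (blocks≤ (+ 1)) ,
  subst₂ _≤_ (occurrences-block-- {1} {proj₁ pm} {proj₂ pm} _ [])
             (occurrences-block-- {1} {proj₁ pm′} {proj₂ pm′} _ []) (blocks≤ (- (+ 1)))
  where
  pm  = factorPair (T i)  (suc p , suc m)
  pm′ = factorPair (T′ i) (suc p , suc m)
  σ = towerˢ i (suc p , suc m)
  τ≤τ′ : τ ⊑ τ′
  τ≤τ′ z = ℕ.≤-trans
    -- The explicit values are compared with the chosen ones through the common prefixes, on both
    -- sides of `T≼T′`.
    (eventualValue-⊑ {τ = τ} {T · σ} ev (proj₂ (eventualValue T σ)) (λ _ _ → ℕ.≤-refl) z)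
    (ℕ.≤-trans (T≼T′ σ z)
      (eventualValue-⊑ {τ = T′ · σ} {τ′} (proj₂ (eventualValue T′ σ)) ev′ (λ _ _ → ℕ.≤-refl) z))
  blocks≤ : ∀ z → occurrences z (block 1 pm []) ≤ occurrences z (block 1 pm′ [])
  blocks≤ z = subst₂ (λ xs ys → occurrences z xs ≤ occurrences z ys) eq eq′ (τ≤τ′ z)

_≤²_ : ℕ × ℕ → ℕ × ℕ → Set
(p , m) ≤² (q , l) = p ≤ q × m ≤ l

-- At (2 , 3) and (3 , 2) the four factors leave
--   ρ₃ : (0 , 1), (1 , 0);      ρ₁ρ₃ : (0 , 2), (0 , 1);
--   ρ₂ρ₃ : (1 , 0), (2 , 0);    ρ₁ρ₂ρ₃ : (0 , 0), (0 , 0).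
⊴-from-tests : ∀ ab cd → factorPair ab (2 , 3) ≤² factorPair cd (2 , 3) →
               factorPair ab (3 , 2) ≤² factorPair cd (3 , 2) → ab ⊴ cd
⊴-from-tests (true  , true)  cd              _        _        = inj₁ refl
⊴-from-tests (true  , false) (true  , false) _        _        = inj₂ refl
⊴-from-tests (false , true)  (false , true)  _        _        = inj₂ refl
⊴-from-tests (false , false) (false , false) _        _        = inj₂ refl
⊴-from-tests (true  , false) (true  , true)  (_ , ()) _
⊴-from-tests (true  , false) (false , true)  (_ , ()) _
⊴-from-tests (true  , false) (false , false) (_ , s≤s ()) _
⊴-from-tests (false , true)  (true  , true)  (() , _) _
⊴-from-tests (false , true)  (true  , false) (() , _) _
⊴-from-tests (false , true)  (false , false) (() , _) _
⊴-from-tests (false , false) (true  , true)  (_ , ()) _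
⊴-from-tests (false , false) (true  , false) _        (() , _)
⊴-from-tests (false , false) (false , true)  (_ , ()) _

≼⇒⊴ʳ : ∀ {T T′} → T ≼ T′ → T ⊴ʳ T′
≼⇒⊴ʳ {T} {T′} T≼T′ i = ⊴-from-tests (T i) (T′ i)
  -- These are the predecessors of the entries of (2 , 3) and (3 , 2). The first pair alone would
  -- not do: there ρ₃ leaves (0 , 1), which lies below the (0 , 2) left by ρ₁ρ₃.
  (factorPair-mono T≼T′ i 1 2) (factorPair-mono T≼T′ i 2 1)

-- Meets and joins of exponents

⊴⇒≡ : ∀ {ab cd} → ab ⊴ cd → ab ≢ 𝟙𝟙 → ab ≡ cd
⊴⇒≡ (inj₁ ab≡) ab≢ = contradiction ab≡ ab≢
⊴⇒≡ (inj₂ ab≡) ab≢ = ab≡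

⊴𝟙𝟙 : ∀ {ab} → ab ⊴ 𝟙𝟙 → ab ≡ 𝟙𝟙
⊴𝟙𝟙 = [ id , id ]′

⊴-trans : ∀ {ab cd ef} → ab ⊴ cd → cd ⊴ ef → ab ⊴ ef
⊴-trans (inj₁ refl) _    = inj₁ refl
⊴-trans (inj₂ refl) b⊴c = b⊴c

⊴-antisym : ∀ {ab cd} → ab ⊴ cd → cd ⊴ ab → ab ≡ cd
⊴-antisym (inj₂ eq)   _         = eq
⊴-antisym (inj₁ refl) (inj₁ eq) = sym eq
⊴-antisym (inj₁ refl) (inj₂ eq) = sym eq

_≟ᴱ_ : DecidableEquality Exponents
_≟ᴱ_ = Product.≡-dec Bool._≟_ Bool._≟_

-- Two distinct exponents other than `𝟙𝟙` have no common upper bound; `join` then returns the first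
-- as a default value.
meet join : Exponents → Exponents → Exponents
meet ab cd with ab ≟ᴱ cd
... | yes _ = ab
... | no  _ = 𝟙𝟙
join ab cd with ab ≟ᴱ 𝟙𝟙
... | yes _ = cd
... | no  _ = ab

meet-diag : ∀ ab → meet ab ab ≡ ab
meet-diag ab with ab ≟ᴱ ab
... | yes _ = refl
... | no ¬p = contradiction refl ¬p

meet-≢ : ∀ {ab cd} → ab ≢ cd → meet ab cd ≡ 𝟙𝟙
meet-≢ {ab} {cd} ab≢cd with ab ≟ᴱ cd
... | yes p = contradiction p ab≢cd
... | no  _ = refl

meet-⊴ˡ : ∀ ab cd → meet ab cd ⊴ ab
meet-⊴ˡ ab cd with ab ≟ᴱ cd
... | yes _ = inj₂ refl
... | no  _ = inj₁ refl

meet-⊴ʳ : ∀ ab cd → meet ab cd ⊴ cd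
meet-⊴ʳ ab cd with ab ≟ᴱ cd
... | yes p = inj₂ p
... | no  _ = inj₁ refl

meet-greatest : ∀ {ab cd ef} → ef ⊴ ab → ef ⊴ cd → ef ⊴ meet ab cd
meet-greatest (inj₁ eq)   _           = inj₁ eq
meet-greatest (inj₂ _)    (inj₁ eq)   = inj₁ eq
meet-greatest (inj₂ refl) (inj₂ refl) = inj₂ (sym (meet-diag _))

join-≢ : ∀ {ab} cd → ab ≢ 𝟙𝟙 → join ab cd ≡ ab
join-≢ {ab} cd ab≢ with ab ≟ᴱ 𝟙𝟙
... | yes p = contradiction p ab≢
... | no  _ = refl

join-⊴ˡ : ∀ ab cd → ab ⊴ join ab cd
join-⊴ˡ ab cd with ab ≟ᴱ 𝟙𝟙
... | yes p = inj₁ p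
... | no  _ = inj₂ refl

-- The common bound `ef` excludes the default case of `join`: two exponents other than `𝟙𝟙` below
-- `ef` both equal `ef`.
join-⊴ʳ : ∀ {ab cd ef} → ab ⊴ ef → cd ⊴ ef → cd ⊴ join ab cd
join-⊴ʳ {ab} ab⊴ cd⊴ with ab ≟ᴱ 𝟙𝟙 | ab⊴ | cd⊴
... | yes _ | _         | _         = inj₂ refl
... | no ¬p | inj₁ p    | _         = contradiction p ¬p
... | no _  | _         | inj₁ q    = inj₁ q
... | no _  | inj₂ refl | inj₂ refl = inj₂ refl

join-least : ∀ {ab cd ef} → ab ⊴ ef → cd ⊴ ef → join ab cd ⊴ ef
join-least {ab} ab⊴ cd⊴ with ab ≟ᴱ 𝟙𝟙
... | yes _ = cd⊴
... | no  _ = ab⊴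

-- The formulas for the index sets

module _ (T T′ : ℛ₁₂₃) where

  meetʳ joinʳ : ℛ₁₂₃
  meetʳ i = meet (T i) (T′ i)
  joinʳ i = join (T i) (T′ i)

  meet-formula : MeetFormula T T′ meetʳ
  meet-formula = ((λ {i} → to {i}) , λ {i} → from {i}) , λ ab ab≢ → (λ {i} → to′ ab ab≢ {i}) , from′ ab
    where
    to : 𝓘 meetʳ 𝟙𝟙 ⊆ _
    to {i} eq with T i ≟ᴱ T′ i | T i ≟ᴱ 𝟙𝟙
    ... | _        | yes p = inj₁ p
    ... | yes _    | no ¬p = contradiction eq ¬p
    -- The index lies in the symmetric difference belonging to the exponent `T i`.
    ... | no T≢T′ | no ¬p = inj₂ (inj₂ ((T i , ¬p) , inj₁ (refl , T≢T′ ∘ sym)))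
    from : _ ⊆ 𝓘 meetʳ 𝟙𝟙
    from {i} (inj₁ T≡)         = ⊴𝟙𝟙 (subst (meetʳ i ⊴_) T≡ (meet-⊴ˡ (T i) (T′ i)))
    from {i} (inj₂ (inj₁ T′≡)) = ⊴𝟙𝟙 (subst (meetʳ i ⊴_) T′≡ (meet-⊴ʳ (T i) (T′ i)))
    from {i} (inj₂ (inj₂ (_ , inj₁ (T≡ , T′≢)))) = meet-≢ λ eq → T′≢ (trans (sym eq) T≡)
    from {i} (inj₂ (inj₂ (_ , inj₂ (T′≡ , T≢)))) = meet-≢ λ eq → T≢ (trans eq T′≡)
    to′ : ∀ ab → ab ≢ 𝟙𝟙 → 𝓘 meetʳ ab ⊆ _
    to′ ab ab≢ {i} eq with T i ≟ᴱ T′ i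
    ... | yes p = eq , trans (sym p) eq
    ... | no  _ = contradiction (sym eq) ab≢
    from′ : ∀ ab {i} → T i ≡ ab × T′ i ≡ ab → meetʳ i ≡ ab
    from′ ab (T≡ , T′≡) = trans (cong₂ meet T≡ T′≡) (meet-diag ab)

  module _ {R : ℛ₁₂₃} (T⊴R : T ⊴ʳ R) (T′⊴R : T′ ⊴ʳ R) where

    -- Below `R`, the words `T` and `T′` agree wherever both differ from `𝟙𝟙`, so `joinʳ` loses no
    -- factor of `T′`.
    join-formula : JoinFormula T T′ joinʳ
    join-formula = ((λ {i} → to {i}) , λ {i} (T≡ , T′≡) → cong₂ join T≡ T′≡) ,
      λ ab ab≢ → (λ {i} → to′ ab {i}) , λ {i} → from′ ab ab≢ {i}
      where
      to : ∀ {i} → joinʳ i ≡ 𝟙𝟙 → T i ≡ 𝟙𝟙 × T′ i ≡ 𝟙𝟙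
      to {i} eq with T i ≟ᴱ 𝟙𝟙
      ... | yes p = p , eq
      ... | no ¬p = contradiction eq ¬p
      to′ : ∀ ab {i} → joinʳ i ≡ ab → T i ≡ ab ⊎ T′ i ≡ ab
      to′ ab {i} eq with T i ≟ᴱ 𝟙𝟙
      ... | yes _ = inj₂ eq
      ... | no  _ = inj₁ eq
      from′ : ∀ ab → ab ≢ 𝟙𝟙 → ∀ {i} → T i ≡ ab ⊎ T′ i ≡ ab → joinʳ i ≡ ab
      from′ ab ab≢ {i} (inj₁ refl) = join-≢ (T′ i) ab≢
      from′ ab ab≢ {i} (inj₂ refl) = sym (⊴⇒≡ (join-⊴ʳ (T⊴R i) (T′⊴R i)) ab≢)

-- The interval as a lattice and as a power set

⟨·⟩₌-least : ∀ T → ⟨·⟩₌ ≼ T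
⟨·⟩₌-least T = ⊴ʳ⇒≼ λ _ → inj₁ refl

-- Below `ef` an exponent is either `𝟙𝟙` or `ef` itself, so the order only compares which exponents
-- differ from `𝟙𝟙`.
⊴-from-≢ : ∀ {ab cd ef} → ab ⊴ ef → cd ⊴ ef → (ab ≢ 𝟙𝟙 → cd ≢ 𝟙𝟙) → ab ⊴ cd
⊴-from-≢ {ab} ab⊴ cd⊴ ab≢⇒cd≢ with ab ≟ᴱ 𝟙𝟙
... | yes p = inj₁ p
... | no ¬p = inj₂ (trans (⊴⇒≡ ab⊴ ¬p) (sym (⊴⇒≡ cd⊴ (ab≢⇒cd≢ ¬p))))

module _ (R : ℛ₁₂₃) where

  private
    I = Interval ⟨·⟩₌ R

  ≼R : (T : I) → proj₁ T ⊴ʳ R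
  ≼R (_ , _ , T≼R) = ≼⇒⊴ʳ T≼R

  interval : ∀ T → T ⊴ʳ R → I
  interval T T⊴R = T , ⟨·⟩₌-least T , ⊴ʳ⇒≼ T⊴R

  _∧ᴵ_ _∨ᴵ_ : Op₂ I
  T ∧ᴵ T′ = interval (meetʳ (proj₁ T) (proj₁ T′))
    λ i → ⊴-trans (meet-⊴ˡ (proj₁ T i) (proj₁ T′ i)) (≼R T i)
  T ∨ᴵ T′ = interval (joinʳ (proj₁ T) (proj₁ T′)) λ i → join-least (≼R T i) (≼R T′ i)

  isLattice : IsLattice {A = I} _≈ᴵ_ _≼ᴵ_ _∨ᴵ_ _∧ᴵ_
  isLattice = record
    { isPartialOrder = record
      { isPreorder = record
        { isEquivalence = record
          { refl  = λ _ → refl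
          ; sym   = λ p i → sym (p i)
          ; trans = λ p q i → trans (p i) (q i)
          }
        ; reflexive = λ T≗T′ → ⊴ʳ⇒≼ λ i → inj₂ (T≗T′ i)
        ; trans     = λ T≼T′ T′≼T″ σ z → ℕ.≤-trans (T≼T′ σ z) (T′≼T″ σ z)
        }
      ; antisym = λ T≼T′ T′≼T i → ⊴-antisym (≼⇒⊴ʳ T≼T′ i) (≼⇒⊴ʳ T′≼T i)
      }
    ; supremum = λ T T′ →
        ⊴ʳ⇒≼ (λ i → join-⊴ˡ (proj₁ T i) (proj₁ T′ i)) ,
        ⊴ʳ⇒≼ (λ i → join-⊴ʳ (≼R T i) (≼R T′ i)) ,
        λ S T≼S T′≼S → ⊴ʳ⇒≼ λ i → join-least (≼⇒⊴ʳ T≼S i) (≼⇒⊴ʳ T′≼S i)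
    ; infimum = λ T T′ →
        ⊴ʳ⇒≼ (λ i → meet-⊴ˡ (proj₁ T i) (proj₁ T′ i)) ,
        ⊴ʳ⇒≼ (λ i → meet-⊴ʳ (proj₁ T i) (proj₁ T′ i)) ,
        λ S S≼T S≼T′ → ⊴ʳ⇒≼ λ i → meet-greatest (≼⇒⊴ʳ S≼T i) (≼⇒⊴ʳ S≼T′ i)
    }

  supp : I → 𝒫ᵈ (support R)
  supp T = (P , λ {i} → P⊆ {i}) , λ i → ¬? (proj₁ T i ≟ᴱ 𝟙𝟙)
    where
    P : Pred ℕ 0ℓ
    P i = proj₁ T i ≢ 𝟙𝟙
    P⊆ : P ⊆ support R
    P⊆ {i} T≢ = (R i , subst (_≢ 𝟙𝟙) (⊴⇒≡ (≼R T i) T≢) T≢) , refl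

  supp-mono : ∀ {T T′} → T ≼ᴵ T′ → supp T ⊆ᵈ supp T′
  supp-mono T≼T′ {i} T≢ = subst (_≢ 𝟙𝟙) (⊴⇒≡ (≼⇒⊴ʳ T≼T′ i) T≢) T≢

  supp-cancel : ∀ {T T′} → supp T ⊆ᵈ supp T′ → T ≼ᴵ T′
  supp-cancel {T} {T′} T⊆T′ = ⊴ʳ⇒≼ λ i → ⊴-from-≢ (≼R T i) (≼R T′ i) (T⊆T′ {i})

  -- The inverse of `supp`; deciding `P` is what makes the sequence of factors a function.
  restrict : {P : Pred ℕ 0ℓ} → Decidable P → ℛ₁₂₃
  restrict P? i with P? i
  ... | yes _ = R i
  ... | no  _ = 𝟙𝟙

  restrict-⊴ : ∀ {P} (P? : Decidable P) → restrict P? ⊴ʳ R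
  restrict-⊴ P? i with P? i
  ... | yes _ = inj₂ refl
  ... | no  _ = inj₁ refl

  -- Surjectivity between setoids concerns every `T` pointwise equal to the preimage, hence the
  -- hypothesis `T≗`.
  supp-restrict : ∀ ((((P , P⊆) , P?)) : 𝒫ᵈ (support R)) {T : I} →
                  proj₁ T ≗ restrict P? → supp T ≐ᵈ ((P , λ {i} → P⊆ {i}) , P?)
  supp-restrict ((P , P⊆) , P?) {T} T≗ = (λ {i} → to {i}) , λ {i} → from {i}
    where
    to : ∀ {i} → proj₁ T i ≢ 𝟙𝟙 → P i
    to {i} T≢ with P? i | T≗ i
    ... | yes Pi | _ = Pi
    ... | no _   | p = contradiction p T≢
    from : ∀ {i} → P i → proj₁ T i ≢ 𝟙𝟙
    from {i} Pi T≡ with P? i | T≗ i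
    ... | no ¬Pi | _ = ¬Pi Pi
    -- Since `P` lies in `support R`, restoring the factor `R i` gives an exponent other than `𝟙𝟙`.
    ... | yes _  | p with (ab , ab≢) , R≡ab ← P⊆ Pi = ab≢ (trans (sym R≡ab) (trans (sym p) T≡))

  supp-isOrderIsomorphism : IsOrderIsomorphism {A = I} _≈ᴵ_ _≐ᵈ_ _≼ᴵ_ _⊆ᵈ_ supp
  supp-isOrderIsomorphism = record
    { isOrderMonomorphism = record
      { isOrderHomomorphism = record
        { cong = λ T≗T′ → (λ {i} T≢ → T≢ ∘ trans (T≗T′ i)) , λ {i} T′≢ → T′≢ ∘ trans (sym (T≗T′ i))
        ; mono = λ {T} {T′} T≼T′ {i} → supp-mono {T} {T′} T≼T′ {i}
        }
      ; injective = λ {T} {T′} (T⊆T′ , T′⊆T) i → ⊴-antisym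
          (⊴-from-≢ (≼R T i) (≼R T′ i) (T⊆T′ {i})) (⊴-from-≢ (≼R T′ i) (≼R T i) (T′⊆T {i}))
      ; cancel = λ {T} {T′} T⊆T′ → supp-cancel {T} {T′} (λ {i} → T⊆T′ {i})
      }
    ; surjective = λ (A , P?) → interval (restrict P?) (restrict-⊴ P?) ,
        λ {T} T≗ → supp-restrict (A , P?) {T} T≗
    }

corollary24 : (R : ℛ₁₂₃) →
    (Σ (Op₂ (Interval ⟨·⟩₌ R)) λ _∧_ → Σ (Op₂ (Interval ⟨·⟩₌ R)) λ _∨_ →
    (∀ T T′ → MeetFormula (proj₁ T) (proj₁ T′) (proj₁ (T ∧ T′))) ×
    (∀ T T′ → JoinFormula (proj₁ T) (proj₁ T′) (proj₁ (T ∨ T′))) ×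
    IsLattice _≈ᴵ_ _≼ᴵ_ _∨_ _∧_) ×
    (Σ[ f ∈ (Interval ⟨·⟩₌ R → 𝒫ᵈ (support R)) ]
    IsOrderIsomorphism _≈ᴵ_ _≐ᵈ_ _≼ᴵ_ _⊆ᵈ_ f) ×
    (ExcludedMiddle 0ℓ →
    Σ[ f ∈ (Interval ⟨·⟩₌ R → 𝒫 (support R)) ]
    IsOrderIsomorphism _≈ᴵ_ _≐ᴾ_ _≼ᴵ_ _⊆ᴾ_ f)
corollary24 R =
  ( _∧ᴵ_ R , _∨ᴵ_ R
  , (λ T T′ → meet-formula (proj₁ T) (proj₁ T′))
  , (λ T T′ → join-formula (proj₁ T) (proj₁ T′) (≼R R T) (≼R R T′))
  , isLattice R
  ) ,
  (supp R , supp-isOrderIsomorphism R) ,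
  -- The relations on `𝒫ᵈ` compare only the underlying sets, so all fields carry over; excluded
  -- middle supplies the decision procedure for surjectivity.
  λ em → proj₁ ∘ supp R , record
    { isOrderMonomorphism = record
      { isOrderHomomorphism = record
        { cong = λ {T} {T′} → Iso.cong {T} {T′}
        ; mono = λ {T} {T′} → Iso.mono {T} {T′}
        }
      ; injective = λ {T} {T′} → Iso.injective {T} {T′}
      ; cancel    = λ {T} {T′} → Iso.cancel {T} {T′}
      }
    ; surjective = λ A → Iso.surjective (A , λ _ → em)
    }
  where module Iso = IsOrderIsomorphism (supp-isOrderIsomorphism R)
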